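{- Let $n\ge 1$. For $a,b\in\widehat{\mathcal F_n}$ put $\mathrm d(a,b)=2^{ -\min\{i\in\mathbb N\,\mid\, a\cap K_n^i\ne b\cap K_n^i\}}$, with the convention $2^{ -\min\emptyset}=0$. Then $(\widehat{\mathcal F_n},\mathrm d)$ is a compact Hausdorff metric space. The metric topology is the profinite topology, and the Heyting algebra operations are continuous. Moreover, $\widehat{\mathcal F_n}$ is the metric completion of its dense subset $\mathcal F_n$.
   Context: Fix $n\ge1$ and symbols $P_1,\dots,P_n$. The partially ordered set $(K_n,\le)$ with valuation map $\mathrm{val}:K_n\to\mathfrak P(\{P_1,\dots,P_n\})$ is the increasing union of finite sets $K_n^d$ ($d\ge 0$) built recursively: $K_n^{ -1}=\emptyset$, and $K_n^d\setminus K_n^{d-1}$ consists of exactly one point $w_{\beta,Y}$ for each pair $(\beta,Y)$ such that (i) $Y$ is a decreasing subset of $K_n^{d-1}$ with $Y\not\subseteq K_n^{d-2}$ (for $d=0$ this last condition is void, so $Y=\emptyset$); (ii) $\beta\subseteq\{P_1,\dots,P_n\}$ and $\beta\subseteq\mathrm{val}(w')$ for all $w'\in Y$; (iii) if $Y$ is the decreasing set generated by a single element $w_{\beta',Y'}$, then $\beta\ne\beta'$. One sets $\mathrm{val}(w_{\beta,Y})=\beta$, and $w\le w_{\beta,Y}$ iff $w\in Y$ or $w=w_{\beta,Y}$. $\widehat{\mathcal F_n}:=\mathcal O_\downarrow(K_n,\le)$ is the Heyting algebra of all decreasing subsets of $K_n$ ($\sqcap=\cap$, $\sqcup=\cup$,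 $a\to b$ = the largest decreasing set contained in $(K_n\setminus a)\cup b$). By a theorem of Bellissima, the Heyting sub-algebra of $\widehat{\mathcal F_n}$ generated by $g_i=\{w\in K_n: P_i\in\mathrm{val}(w)\}$, $i=1,\dots,n$, is free on $g_1,\dots,g_n$; the free Heyting algebra $\mathcal F_n$ is identified with it. The profinite topology on $\widehat{\mathcal F_n}$ is the initial topology for the maps $\widehat\pi_i:\widehat{\mathcal F_n}\to\mathcal O_\downarrow(K_n^i,\le)$, $a\mapsto a\cap K_n^i$ ($i\in\mathbb N$), where the finite targets carry the discrete topology ($\widehat{\mathcal F_n}$ being the projective limit of these finite Heyting algebras). -}

module Defs where

open import Axiom.ExcludedMiddle using (ExcludedMiddle)
open import Data.Bool.Base using (Bool; T)
open import Data.Empty using (⊥)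
open import Data.Fin.Base using (Fin)
import Data.Fin.Subset as Sub
open import Data.Integer.Base using (+_)
open import Data.List.Base using (List)
open import Data.List.Relation.Unary.All using (All)
open import Data.List.Relation.Unary.Any using (Any)
open import Data.Nat.Base as ℕ using (ℕ; zero; suc)
import Data.Nat.Properties as ℕₚ
open import Data.Product using (Σ; ∃; _×_; _,_; proj₁; proj₂)
open import Data.Rational.Base using (ℚ; 0ℚ; _<_; _/_)
open import Data.Sum using (_⊎_; inj₁; inj₂)
open import Data.Unit using (⊤; tt)
open import Function.Base using (_∘_)
open import Function.Bundles using (_⇔_; Equivalence)
open import Function.Metric.Rational.Core using (DistanceFunction)
open import Level using (Level; 0ℓ; _⊔_) renaming (suc to lsuc)
open import Relation.Binary.Bundles using (Poset)
open import Relation.Binary.Core using (Rel)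
open import Relation.Binary.Definitions using (_Respects_)
import Relation.Binary.Construct.On as On
open import Relation.Binary.Lattice.Bundles using (HeytingAlgebra)
open import Relation.Binary.PropositionalEquality
  using (_≡_; _≢_; refl; sym; trans; subst)
open import Relation.Nullary using (¬_; Dec; yes; no; contradiction)
open import Relation.Unary using (Pred; _∈_; _∉_; _⊆_; _∪_; _∩_; ∁; _⊢_)

private
  variable
    a b ℓ o₁ o₂ : Level
    A B : Set a

------------------------------------------------------------------------
-- Topology.  A topology on A is given by its predicate of open sets.

Topology : Set a → (ℓ o : Level) → Set (a ⊔ lsuc ℓ ⊔ lsuc o)
Topology A ℓ o = Pred (Pred A ℓ) o

-- The subsets of a set with equality _≈_ are the predicates that
-- respect _≈_; in the discrete topology all of them are open.

Discrete : Rel A o₁ → Topology A ℓ _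
Discrete _≈_ V = V Respects _≈_

-- U is a union of finite intersections of sets f i ⁻¹ V with V open.

Initial : ∀ {I : Set a} {Y : I → Set b} →
          (∀ i → Topology (Y i) ℓ o₁) → (∀ i → A → Y i) → Topology A ℓ _
Initial {ℓ = ℓ} {A = A} {I = I} {Y} 𝒯 f U = ∀ {x} → x ∈ U →
  ∃ λ (Vs : List Subbasic) →
    All (x inside_) Vs × (∀ {z} → All (z inside_) Vs → z ∈ U)
  where
  Subbasic : Set _
  Subbasic = Σ I λ i → ∃ λ (V : Pred (Y i) ℓ) → V ∈ 𝒯 i

  _inside_ : A → Subbasic → Set ℓ
  z inside (i , V , _) = f i z ∈ V

_⊗_ : Topology A ℓ o₁ → Topology B ℓ o₂ → Topology (A × B) ℓ _
_⊗_ 𝒮 𝒯 W = ∀ {x y} → (x , y) ∈ W →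
  ∃ λ U → ∃ λ V → U ∈ 𝒮 × V ∈ 𝒯 × x ∈ U × y ∈ V ×
    (∀ {x′ y′} → x′ ∈ U → y′ ∈ V → (x′ , y′) ∈ W)

Continuous : Topology A ℓ o₁ → Topology B ℓ o₂ → (A → B) → Set _
Continuous 𝒮 𝒯 f = ∀ V → V ∈ 𝒯 → (f ⊢ V) ∈ 𝒮

Compact : (ι : Level) → Topology A ℓ o₁ → Set _
Compact {A = A} {ℓ = ℓ} ι 𝒯 =
  (I : Set ι) (U : I → Pred A ℓ) → (∀ i → U i ∈ 𝒯) →
  (∀ x → ∃ λ i → x ∈ U i) →
  ∃ λ (is : List I) → ∀ x → Any (λ i → x ∈ U i) is

Hausdorff : Rel A o₂ → Topology A ℓ o₁ → Set _
Hausdorff _≈_ 𝒯 = ∀ x y → ¬ (x ≈ y) →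
  ∃ λ U → ∃ λ V → U ∈ 𝒯 × V ∈ 𝒯 × x ∈ U × y ∈ V ×
    (∀ z → ¬ (z ∈ U × z ∈ V))

------------------------------------------------------------------------
-- Metric notions.  Distances are rational, as in Function.Metric.Rational.

MetricTopology : DistanceFunction A → Topology A ℓ _
MetricTopology d U = ∀ {x} → x ∈ U →
  ∃ λ ε → 0ℚ < ε × (∀ {y} → d x y < ε → y ∈ U)

Cauchy : DistanceFunction A → (ℕ → A) → Set
Cauchy d s = ∀ ε → 0ℚ < ε →
  ∃ λ N → ∀ j k → N ℕ.≤ j → N ℕ.≤ k → d (s j) (s k) < ε

_Converges_to_ : {A : Set a} → DistanceFunction A → (ℕ → A) → A → Set
d Converges s to x = ∀ ε → 0ℚ < ε → ∃ λ N → ∀ k → N ℕ.≤ k → d (s k) x < ε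

Complete : DistanceFunction A → Set _
Complete d = ∀ s → Cauchy d s → ∃ λ x → d Converges s to x

record IsMetricCompletion {A : Set a} {B : Set b}
  (dA : DistanceFunction A) (dB : DistanceFunction B) (e : A → B) :
  Set (a ⊔ b) where
  field
    isometric : ∀ x y → dB (e x) (e y) ≡ dA x y
    dense     : ∀ y ε → 0ℚ < ε → ∃ λ x → dB (e x) y < ε
    complete  : Complete dB

------------------------------------------------------------------------
-- The least subset of a Heyting algebra which contains the g i and is
-- closed under the operations (and under the equality of the algebra).

module _ {c ℓ₁ ℓ₂ i} (H : HeytingAlgebra c ℓ₁ ℓ₂) {I : Set i}
         (g : I → HeytingAlgebra.Carrier H) where

  private module H = HeytingAlgebra H

  data Generated : Pred H.Carrier (c ⊔ ℓ₁ ⊔ i) where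
    gen  : ∀ j → Generated (g j)
    top  : Generated H.⊤
    bot  : Generated H.⊥
    meet : ∀ {x y} → Generated x → Generated y → Generated (x H.∧ y)
    join : ∀ {x y} → Generated x → Generated y → Generated (x H.∨ y)
    imp  : ∀ {x y} → Generated x → Generated y → Generated (x H.⇨ y)
    resp : ∀ {x y} → x H.≈ y → Generated x → Generated y

------------------------------------------------------------------------
-- Decreasing subsets of a poset.  A decreasing set automatically
-- respects the equality of the poset.

record DownSet (P : Poset 0ℓ 0ℓ 0ℓ) : Set₁ where
  open Poset P
  field
    set        : Pred Carrier 0ℓ
    decreasing : ∀ {u v} → u ≤ v → v ∈ set → u ∈ set

open DownSet public

module _ {P : Poset 0ℓ 0ℓ 0ℓ} where

  open Poset P using (_≤_) renaming (Carrier to ∣P∣; refl to ≤-refl; trans to ≤-trans)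

  interior : Pred ∣P∣ 0ℓ → DownSet P
  interior S .set v                 = ∀ {u} → u ≤ v → u ∈ S
  interior S .decreasing u≤v v∈ w≤u = v∈ (≤-trans w≤u u≤v)

  -- interior S is the largest decreasing set contained in S.

  interior-⊆ : ∀ S → set (interior S) ⊆ S
  interior-⊆ S v∈ = v∈ ≤-refl

  interior-greatest : ∀ S (x : DownSet P) → set x ⊆ S → set x ⊆ set (interior S)
  interior-greatest S x x⊆S v∈x u≤v = x⊆S (decreasing x u≤v v∈x)

module _ (em : ∀ {ℓ} → ExcludedMiddle ℓ) (P : Poset 0ℓ 0ℓ 0ℓ) where

  𝒪↓ : HeytingAlgebra (lsuc 0ℓ) 0ℓ 0ℓ
  𝒪↓ = record
    { Carrier = DownSet P
    ; _≈_     = λ x y → set x ⊆ set y × set y ⊆ set x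
    ; _≤_     = λ x y → set x ⊆ set y
    ; _∨_     = λ x y → record
        { set        = set x ∪ set y
        ; decreasing = λ { u≤v (inj₁ p) → inj₁ (decreasing x u≤v p)
                         ; u≤v (inj₂ q) → inj₂ (decreasing y u≤v q) } }
    ; _∧_     = λ x y → record
        { set        = set x ∩ set y
        ; decreasing = λ { u≤v (p , q) → decreasing x u≤v p , decreasing y u≤v q } }
    ; _⇨_     = λ x y → interior (∁ (set x) ∪ set y)
    ; ⊤       = record { set = λ _ → ⊤ ; decreasing = λ _ _ → tt }
    ; ⊥       = record { set = λ _ → ⊥ ; decreasing = λ _ () }
    ; isHeytingAlgebra = record
        { isBoundedLattice = record
            { isLattice = record
                { isPartialOrder = record
                    { isPreorder = record
                        { isEquivalence = record
                            { refl  = (λ p → p) , (λ p → p)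
                            ; sym   = λ (f , g) → g , f
                            ; trans = λ (f , g) (h , k) → h ∘ f , g ∘ k }
                        ; reflexive = proj₁
                        ; trans     = λ f g → g ∘ f }
                    ; antisym = _,_ }
                ; supremum = λ x y → inj₁ , inj₂ ,
                    λ z f g → λ { (inj₁ p) → f p ; (inj₂ q) → g q }
                ; infimum  = λ x y → proj₁ , proj₂ , λ z f g p → f p , g p }
            ; maximum = λ x _ → tt
            ; minimum = λ x () }
        ; exponential = λ w x y →
            (λ f {v} v∈w {u} u≤v → cases x y (λ u∈x → f (decreasing w u≤v v∈w , u∈x)))
          , (λ f (v∈w , v∈x) → modusPonens (f v∈w ≤-refl) v∈x) }
    }
    where
    open Poset P using () renaming (Carrier to ∣P∣; refl to ≤-refl)

    cases : ∀ (x y : DownSet P) {u} →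
            (u ∈ set x → u ∈ set y) → u ∈ (∁ (set x) ∪ set y)
    cases x y {u} f with em {P = u ∈ set x}
    ... | yes p = inj₂ (f p)
    ... | no ¬p = inj₁ ¬p

    modusPonens : {X Y : Set} → (¬ X) ⊎ Y → X → Y
    modusPonens (inj₁ ¬p) p = contradiction p ¬p
    modusPonens (inj₂ q)  _ = q

------------------------------------------------------------------------
-- The poset K_n.  The symbols P_1,…,P_n are the elements of Fin n, and
-- 𝔓({P_1,…,P_n}) is Sub.Subset n.

module _ (n : ℕ) where

  -- What the recursion needs to know about the finite set K_n^{d-1}.
  -- NotInPrevious Y stands for Y ⊈ K_n^{d-2} (void for d = 0).

  record Stage : Set₁ where
    field
      Carrier       : Set
      _≤_           : Rel Carrier 0ℓ
      val           : Carrier → Sub.Subset n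
      NotInPrevious : (Carrier → Bool) → Set

  -- The pairs (β , Y) which yield a point of K_n^d ∖ K_n^{d-1}, where S
  -- is K_n^{d-1}.  Subsets Y of this finite set are Bool-valued.

  record Point (S : Stage) : Set where
    open Stage S
    field
      β             : Sub.Subset n
      Y             : Carrier → Bool
      Y-decreasing  : ∀ {u v} → u ≤ v → T (Y v) → T (Y u)
      Y-new         : NotInPrevious Y
      β⊆val         : ∀ v → T (Y v) → β Sub.⊆ val v
      β≢val         : ∀ v → (∀ u → T (Y u) ⇔ u ≤ v) → β ≢ val v

  open Point public

  -- Equality of points is equality of the pairs (β , Y).

  _≐_ : {S : Stage} → Rel (Point S) 0ℓ
  w ≐ w′ = β w ≡ β w′ × (∀ v → Y w v ≡ Y w′ v)

  extend : Stage → Stage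
  extend S = record
    { Carrier       = S.Carrier ⊎ Point S
    ; _≤_           = λ
        { (inj₁ u) (inj₁ v)  → u S.≤ v
        ; (inj₁ u) (inj₂ w)  → T (Y w u)
        ; (inj₂ w) (inj₁ u)  → ⊥
        ; (inj₂ w) (inj₂ w′) → w ≐ w′ }
    ; val           = λ { (inj₁ u) → S.val u ; (inj₂ w) → β w }
    ; NotInPrevious = λ Y → ¬ (∀ v → T (Y v) → ∃ λ u → v ≡ inj₁ u)
    }
    where module S = Stage S

  -- stage d is K_n^{d-1}.

  stage : ℕ → Stage
  stage zero = record
    { Carrier       = ⊥
    ; _≤_           = λ ()
    ; val           = λ ()
    ; NotInPrevious = λ _ → ⊤
    }
  stage (suc d) = extend (stage d)

  -- The union of the K_n^d, as the disjoint union of the K_n^d ∖ K_n^{d-1}.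

  ∣K∣ : Set
  ∣K∣ = ∃ λ d → Point (stage d)

  rank : ∣K∣ → ℕ
  rank = proj₁

  val : ∣K∣ → Sub.Subset n
  val (_ , w) = β w

  toK : ∀ d → Stage.Carrier (stage d) → ∣K∣
  toK (suc d) (inj₁ u) = toK d u
  toK (suc d) (inj₂ w) = d , w

  data _≈ᴷ_ : Rel ∣K∣ 0ℓ where
    same : ∀ {d} {w w′ : Point (stage d)} → w ≐ w′ → (d , w) ≈ᴷ (d , w′)

  _∈Y_ : Rel ∣K∣ 0ℓ
  x ∈Y (d , w) = ∃ λ u → T (Y w u) × x ≈ᴷ toK d u

  _≤ᴷ_ : Rel ∣K∣ 0ℓ
  x ≤ᴷ y = x ∈Y y ⊎ x ≈ᴷ y

  private
    ≈-refl : ∀ {x} → x ≈ᴷ x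
    ≈-refl = same (refl , λ _ → refl)

    ≈-sym : ∀ {x y} → x ≈ᴷ y → y ≈ᴷ x
    ≈-sym (same (p , q)) = same (sym p , λ v → sym (q v))

    ≈-trans : ∀ {x y z} → x ≈ᴷ y → y ≈ᴷ z → x ≈ᴷ z
    ≈-trans (same (p , q)) (same (r , s)) =
      same (trans p r , λ v → trans (q v) (s v))

    rank-toK : ∀ d u → rank (toK d u) ℕ.< d
    rank-toK (suc d) (inj₁ u) = ℕₚ.m<n⇒m<1+n (rank-toK d u)
    rank-toK (suc d) (inj₂ w) = ℕₚ.n<1+n d

    rank-≈ : ∀ {x y} → x ≈ᴷ y → rank x ≡ rank y
    rank-≈ (same _) = refl

    ∈Y⇒rank< : ∀ {x} y → x ∈Y y → rank x ℕ.< rank y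
    ∈Y⇒rank< (d , w) (u , _ , e) =
      subst (ℕ._< d) (sym (rank-≈ e)) (rank-toK d u)

    ∈Y-respʳ : ∀ {x y z} → x ∈Y y → y ≈ᴷ z → x ∈Y z
    ∈Y-respʳ (u , u∈Y , e) (same (_ , q)) = u , subst T (q u) u∈Y , e

    ∈Y-below : ∀ d v {x} → x ∈Y toK d v →
               ∃ λ u → Stage._≤_ (stage d) u v × x ≈ᴷ toK d u
    ∈Y-below (suc d) (inj₁ v) x∈ with ∈Y-below d v x∈
    ... | u , u≤v , e = inj₁ u , u≤v , e
    ∈Y-below (suc d) (inj₂ w) (u , u∈Y , e) = inj₁ u , u∈Y , e

    ∈Y-trans : ∀ {x y} z → x ∈Y y → y ∈Y z → x ∈Y z
    ∈Y-trans (d , w) x∈y (v , v∈Y , e) with ∈Y-below d v (∈Y-respʳ x∈y e)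
    ... | u , u≤v , e′ = u , Y-decreasing w u≤v v∈Y , e′

    ≤-trans : ∀ {x y z} → x ≤ᴷ y → y ≤ᴷ z → x ≤ᴷ z
    ≤-trans {z = z} (inj₁ p) (inj₁ q) = inj₁ (∈Y-trans z p q)
    ≤-trans (inj₁ p) (inj₂ e) = inj₁ (∈Y-respʳ p e)
    ≤-trans {z = _ , _} (inj₂ e) (inj₁ (u , u∈Y , e′)) = inj₁ (u , u∈Y , ≈-trans e e′)
    ≤-trans (inj₂ e) (inj₂ f) = inj₂ (≈-trans e f)

    ≤-antisym : ∀ {x y} → x ≤ᴷ y → y ≤ᴷ x → x ≈ᴷ y
    ≤-antisym {x} {y} (inj₁ p) (inj₁ q) =
      contradiction (∈Y⇒rank< x q) (ℕₚ.<-asym (∈Y⇒rank< y p))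
    ≤-antisym (inj₁ p) (inj₂ e) = ≈-sym e
    ≤-antisym (inj₂ e) _        = e

    val-≈ : ∀ {x y} → x ≈ᴷ y → val x ≡ val y
    val-≈ (same (p , _)) = p

    val-toK : ∀ d u → Stage.val (stage d) u ≡ val (toK d u)
    val-toK (suc d) (inj₁ u) = val-toK d u
    val-toK (suc d) (inj₂ w) = refl

    val-antitone : ∀ {x y} → x ≤ᴷ y → val y Sub.⊆ val x
    val-antitone {x} {d , w} (inj₁ (u , u∈Y , e)) {i} i∈ =
      subst (i Sub.∈_) (trans (val-toK d u) (sym (val-≈ e))) (β⊆val w u u∈Y i∈)
    val-antitone (inj₂ e) {i} i∈ = subst (i Sub.∈_) (sym (val-≈ e)) i∈

  K : Poset 0ℓ 0ℓ 0ℓ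
  K = record
    { Carrier        = ∣K∣
    ; _≈_            = _≈ᴷ_
    ; _≤_            = _≤ᴷ_
    ; isPartialOrder = record
        { isPreorder = record
            { isEquivalence = record { refl = ≈-refl ; sym = ≈-sym ; trans = ≈-trans }
            ; reflexive     = inj₂
            ; trans         = ≤-trans }
        ; antisym    = ≤-antisym }
    }

  -- The subposet K_n^d.

  K^ : ℕ → Poset 0ℓ 0ℓ 0ℓ
  K^ d = On.poset {B = ∃ λ (w : ∣K∣) → rank w ℕ.≤ d} K proj₁

  π̂ : ∀ d → DownSet K → DownSet (K^ d)
  π̂ d x .set        = proj₁ ⊢ set x
  π̂ d x .decreasing = decreasing x

  g : Fin n → DownSet K
  g i .set w               = i Sub.∈ val w
  g i .decreasing u≤v i∈val = val-antitone u≤v i∈val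

2^-_ : ℕ → ℚ
2^- i = _/_ (+ 1) (2 ℕ.^ i) {{ℕₚ.m^n≢0 2 i}}

IsMin : Pred ℕ 0ℓ → Pred ℕ 0ℓ
IsMin Q i = i ∈ Q × (∀ j → j ∈ Q → i ℕ.≤ j)

-- The theory is classical: excluded middle is an explicit parameter.

module _ (em : ∀ {ℓ} → ExcludedMiddle ℓ) where

  min : (Q : Pred ℕ 0ℓ) → ∃ Q → ∃ (IsMin Q)
  min Q (i , i∈Q) = search i 0 (ℕₚ.+-identityʳ i) (λ _ _ → ℕ.z≤n)
    where
    search : ∀ k m → k ℕ.+ m ≡ i → (∀ j → j ∈ Q → m ℕ.≤ j) → ∃ (IsMin Q)
    search zero    m refl low = m , i∈Q , low
    search (suc k) m eq   low with em {P = m ∈ Q}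
    ... | yes m∈Q = m , m∈Q , low
    ... | no  m∉Q = search k (suc m) (trans (ℕₚ.+-suc k m) eq)
      λ j j∈Q → ℕₚ.≤∧≢⇒< (low j j∈Q) λ { refl → m∉Q j∈Q }

  -- 2^{-min Q}, with 2^{-min ∅} = 0.

  2^-min_ : Pred ℕ 0ℓ → ℚ
  2^-min Q with em {P = ∃ Q}
  ... | yes ne = 2^- proj₁ (min Q ne)
  ... | no  _  = 0ℚ

  module _ (n : ℕ) where

    F̂ : HeytingAlgebra (lsuc 0ℓ) 0ℓ 0ℓ
    F̂ = 𝒪↓ em (K n)

    private
      module O (i : ℕ) = HeytingAlgebra (𝒪↓ em (K^ n i))

    dist : DistanceFunction (HeytingAlgebra.Carrier F̂)
    dist x y = 2^-min (λ i → ¬ (O._≈_ i (π̂ n i x) (π̂ n i y)))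

    ProfiniteTopology : Topology (HeytingAlgebra.Carrier F̂) ℓ _
    ProfiniteTopology = Initial (λ i → Discrete (O._≈_ i)) (π̂ n)

    -- The free Heyting algebra, as the subalgebra of F̂ generated by the g i.

    F : Pred (HeytingAlgebra.Carrier F̂) _
    F = Generated F̂ (g n)

    distF : DistanceFunction (∃ F)
    distF (x , _) (y , _) = dist x y

{-# OPTIONS --safe #-}
-- Everything rests on two facts about K_n.  Each K_n^d is finite, so a decreasing set has
-- finitely many traces on it: the space is totally bounded, and an infinite sequence of ever
-- smaller cylinders without a finite subcover shrinks to a point, which lies in some open set of
-- the cover.  And each principal decreasing set ↓w belongs to F_n, by de Jongh's formulas, so
-- every trace on K_n^d, a finite union of traces of such ↓w, is the trace of an element of F_n.
-- The rest is the ultrametric inequality and the fact that the Heyting operations commute with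
-- a ↦ a ∩ K_n^d.
module Submission where

open import Defs
open import Axiom.DoubleNegationElimination using (em⇒dne)
open import Axiom.ExcludedMiddle using (ExcludedMiddle)
open import Data.Bool.Base using (true; false; T)
open import Data.Empty using (⊥-elim)
import Data.Fin.Subset as Sub
import Data.Fin.Subset.Properties as Subₚ
open import Data.Integer.Base as ℤ using (+_; +<+)
import Data.Integer.Properties as ℤₚ
open import Data.List.Base using (List; []; _∷_; _++_; map; concat; allFin)
open import Data.List.Membership.Propositional using (find; lose)
open import Data.List.Membership.Propositional.Properties using (∈-allFin)
open import Data.List.Relation.Unary.All as All using (All; []; _∷_)
import Data.List.Relation.Unary.All.Properties as Allₚ
open import Data.List.Relation.Unary.Any as Any using (Any; here; there)
import Data.List.Relation.Unary.Any.Properties as Anyₚ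
open import Data.Nat.Base as ℕ using (ℕ; zero; suc; _≥_)
open import Data.Nat.Induction using (<-wellFounded)
import Data.Nat.Properties as ℕₚ
open import Data.Product using (Σ; ∃; _×_; _,_; proj₁; proj₂; uncurry)
open import Data.Rational.Base as ℚ using (ℚ; 0ℚ; _/_; mkℚ; toℚᵘ)
import Data.Rational.Properties as ℚₚ
import Data.Rational.Unnormalised.Base as ℚᵘ
import Data.Rational.Unnormalised.Properties as ℚᵘₚ
open import Data.Sum as ⊎ using (_⊎_; inj₁; inj₂)
open import Data.Unit using (⊤; tt)
open import Function.Base using (_∘_; case_of_; id)
open import Function.Bundles using (_⇔_; mk⇔; module Equivalence)
open import Function.Construct.Composition using (_⇔-∘_)
open import Function.Construct.Identity using (⇔-id)
open import Function.Construct.Symmetry using (⇔-sym)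
open import Function.Metric.Rational.Structures using (IsMetric)
open import Induction.WellFounded using (Acc; acc)
open import Level using (Level; 0ℓ; Lift; lift)
open import Relation.Binary.Bundles using (Poset)
open import Relation.Binary.Lattice.Bundles using (HeytingAlgebra)
open import Relation.Binary.PropositionalEquality
  using (_≡_; _≢_; refl; sym; trans; cong; subst)
open import Relation.Binary.Structures using (IsEquivalence)
open import Relation.Nullary using (¬_; Dec; yes; no; contradiction)
open import Relation.Unary using (Pred; _∈_; _∉_; _⊆_; _∪_; _∩_; ∁)

open Equivalence using (to; from)

-- Negative powers of two

toℚᵘ-1/ : ∀ m .{{_ : ℕ.NonZero m}} → toℚᵘ (+ 1 / m) ℚᵘ.≃ + 1 ℚᵘ./ m
toℚᵘ-1/ (suc m) = ℚₚ.toℚᵘ-fromℚᵘ (ℚᵘ.mkℚᵘ (+ 1) m)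

0<1/ : ∀ m .{{_ : ℕ.NonZero m}} → 0ℚ ℚ.< + 1 / m
0<1/ m@(suc _) = ℚₚ.toℚᵘ-cancel-<
  (ℚᵘₚ.<-respʳ-≃ (ℚᵘₚ.≃-sym (toℚᵘ-1/ m)) (ℚᵘ.*<* (+<+ ℕ.z<s)))

-- A positive rational has numerator at least 1, so it is at least the reciprocal of its
-- denominator.
1/< : ∀ ε m .{{_ : ℕ.NonZero m}} → 0ℚ ℚ.< ε → ℚ.↧ₙ ε ℕ.< m → + 1 / m ℚ.< ε
1/< ε@(mkℚ ℤ.-[1+ _ ] _ _) (suc _) (ℚ.*<* ()) _
1/< ε@(mkℚ (+ zero) _ _)  (suc _) (ℚ.*<* (+<+ ())) _
1/< ε@(mkℚ (+ suc p) q _) m@(suc _) _ q<m = ℚₚ.toℚᵘ-cancel-<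
  (ℚᵘₚ.<-respˡ-≃ (ℚᵘₚ.≃-sym (toℚᵘ-1/ m)) (ℚᵘ.*<*
    (+<+ (ℕₚ.<-≤-trans (subst (ℕ._< m) (sym (ℕₚ.+-identityʳ (suc q))) q<m) (ℕₚ.m≤m+n m _)))))

1/-anti-< : ∀ m k .{{_ : ℕ.NonZero m}} .{{_ : ℕ.NonZero k}} → m ℕ.< k → + 1 / k ℚ.< + 1 / m
1/-anti-< m@(suc _) k@(suc _) m<k = ℚₚ.toℚᵘ-cancel-<
  (ℚᵘₚ.<-respˡ-≃ (ℚᵘₚ.≃-sym (toℚᵘ-1/ k)) (ℚᵘₚ.<-respʳ-≃ (ℚᵘₚ.≃-sym (toℚᵘ-1/ m))
    (ℚᵘ.*<* (ℤₚ.*-monoˡ-<-pos (+ 1) (+<+ m<k)))))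

0<2^- : ∀ i → 0ℚ ℚ.< 2^- i
0<2^- i = 0<1/ (2 ℕ.^ i) {{ℕₚ.m^n≢0 2 i}}

2^-anti-< : ∀ {i j} → i ℕ.< j → 2^- j ℚ.< 2^- i
2^-anti-< {i} {j} i<j = 1/-anti-< (2 ℕ.^ i) (2 ℕ.^ j) {{ℕₚ.m^n≢0 2 i}} {{ℕₚ.m^n≢0 2 j}}
  (ℕₚ.^-monoʳ-< 2 (ℕ.s<s ℕ.z<s) i<j)

2^-anti-≤ : ∀ {i j} → i ℕ.≤ j → 2^- j ℚ.≤ 2^- i
2^-anti-≤ i≤j with ℕₚ.m≤n⇒m<n∨m≡n i≤j
... | inj₁ i<j  = ℚₚ.<⇒≤ (2^-anti-< i<j)
... | inj₂ refl = ℚₚ.≤-refl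

n<2^n : ∀ n → n ℕ.< 2 ℕ.^ n
n<2^n zero    = ℕ.z<s
n<2^n (suc n) = ℕₚ.+-mono-≤ (ℕₚ.m^n>0 2 n) (ℕₚ.≤-trans (n<2^n n) (ℕₚ.m≤m+n _ 0))

2^-archimedean : ∀ ε → 0ℚ ℚ.< ε → ∃ λ i → 2^- i ℚ.< ε
-- The denominator q of ε itself serves as the exponent, because q < 2^q.
2^-archimedean ε 0<ε = ℚ.↧ₙ ε , 1/< ε (2 ℕ.^ ℚ.↧ₙ ε) {{ℕₚ.m^n≢0 2 (ℚ.↧ₙ ε)}} 0<ε (n<2^n _)

-- Finiteness of K_n^d

T-injective : ∀ {x y} → T x ⇔ T y → x ≡ y
T-injective {true}  {true}  _ = refl
T-injective {true}  {false} e = ⊥-elim (to e tt)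
T-injective {false} {true}  e = ⊥-elim (from e tt)
T-injective {false} {false} _ = refl

module _ (em : ∀ {ℓ} → ExcludedMiddle ℓ) {a p : Level} {X : Set a} where

  AgreeOn : List (Pred X p) → X → X → Set _
  AgreeOn Ps x y = All (λ P → x ∈ P ⇔ y ∈ P) Ps

  -- Induction on the list of tests: each net point for `Ps` is replaced by at most two, one for
  -- each value of the new test that occurs in its class.
  finiteNet : (Ps : List (Pred X p)) → ∃ λ (net : List X) → ∀ x → Any (AgreeOn Ps x) net
  finiteNet [] with em {P = X}
  ... | yes c = c ∷ [] , λ x → here []
  ... | no ¬X = [] , λ x → contradiction x ¬X
  finiteNet (P ∷ Ps) = let net , covers = finiteNet Ps in
    concat (map pick net) , λ x → Anyₚ.concat⁺ (Anyₚ.map⁺ (Any.map (picks x) (covers x)))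
    where
    -- `Q` stands for the new test or its complement. Excluded middle yields a representative of
    -- this part of the class of `c`, or shows that the part is empty.
    with-value : (Q : Pred X p) (c : X) → ∃ λ (cs : List X) →
                 ∀ x → x ∈ Q → AgreeOn Ps x c → Any (λ y → y ∈ Q × AgreeOn Ps x y) cs
    with-value Q c with em {P = ∃ λ y → y ∈ Q × AgreeOn Ps y c}
    ... | yes (y , y∈Q , y~c) = y ∷ [] , λ x _ x~c →
            here (y∈Q , All.zipWith (λ (e , f) → ⇔-sym f ⇔-∘ e) (x~c , y~c))
    ... | no ∄y = [] , λ x x∈Q x~c → contradiction (x , x∈Q , x~c) ∄y

    pick : X → List X
    pick c = proj₁ (with-value P c) ++ proj₁ (with-value (∁ P) c)

    picks : ∀ x {c} → AgreeOn Ps x c → Any (AgreeOn (P ∷ Ps) x) (pick c)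
    picks x {c} x~c with em {P = x ∈ P}
    ... | yes x∈P = Anyₚ.++⁺ˡ (Any.map (λ (y∈P , x~y) → mk⇔ (λ _ → y∈P) (λ _ → x∈P) ∷ x~y)
                      (proj₂ (with-value P c) x x∈P x~c))
    ... | no x∉P = Anyₚ.++⁺ʳ (proj₁ (with-value P c))
                     (Any.map (λ (y∉P , x~y) → mk⇔ (λ x∈P → contradiction x∈P x∉P)
                                                    (λ y∈P → contradiction y∈P y∉P) ∷ x~y)
                      (proj₂ (with-value (∁ P) c) x x∉P x~c))

-- Order, rank and extensionality in K_n

module _ (n : ℕ) where
  open Poset (K n) using (_≈_; _≤_) renaming (refl to ≤-refl; trans to ≤-trans; module Eq to ≈)

  infix 4 _≺_
  _≺_ : ∣K∣ n → ∣K∣ n → Set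
  _≺_ = _∈Y_ n

  ≈⇒rank≡ : ∀ {x y} → x ≈ y → rank n x ≡ rank n y
  ≈⇒rank≡ (same _) = refl

  ≈⇒val≡ : ∀ {x y} → x ≈ y → val n x ≡ val n y
  ≈⇒val≡ (same (p , _)) = p

  rank-toK< : ∀ d u → rank n (toK n d u) ℕ.< d
  rank-toK< (suc d) (inj₁ u) = ℕₚ.m<n⇒m<1+n (rank-toK< d u)
  rank-toK< (suc d) (inj₂ w) = ℕₚ.n<1+n d

  ∈Y⇒rank< : ∀ {x} y → x ≺ y → rank n x ℕ.< rank n y
  ∈Y⇒rank< (d , w) (u , _ , e) = subst (ℕ._< d) (sym (≈⇒rank≡ e)) (rank-toK< d u)

  ≤⇒rank≤ : ∀ {x y} → x ≤ y → rank n x ℕ.≤ rank n y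
  ≤⇒rank≤ {y = y} (inj₁ p) = ℕₚ.<⇒≤ (∈Y⇒rank< y p)
  ≤⇒rank≤ (inj₂ e) = ℕₚ.≤-reflexive (≈⇒rank≡ e)

  ∈Y-respˡ : ∀ {x y} w → x ≈ y → y ≺ w → x ≺ w
  ∈Y-respˡ _ x≈y (u , u∈Y , y≈u) = u , u∈Y , ≈.trans x≈y y≈u

  ∈Y-respʳ : ∀ {x} w {z} → x ≺ w → w ≈ z → x ≺ z
  ∈Y-respʳ _ (u , u∈Y , e) (same (_ , q)) = u , subst T (q u) u∈Y , e

  -- Transitivity leaves only `x ≈ w` to exclude, and rank x ≤ rank y < rank w excludes it.
  ≤-∈Y : ∀ {x y} w → x ≤ y → y ≺ w → x ≺ w
  ≤-∈Y w x≤y y∈ with ≤-trans {k = w} x≤y (inj₁ y∈)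
  ... | inj₁ x∈ = x∈
  ... | inj₂ x≈w = contradiction (ℕₚ.≤-<-trans (≤⇒rank≤ x≤y) (∈Y⇒rank< w y∈))
                                 (ℕₚ.<-irrefl (≈⇒rank≡ x≈w))

  val-toK : ∀ d u → val n (toK n d u) ≡ Stage.val (stage n d) u
  val-toK (suc d) (inj₁ u) = val-toK d u
  val-toK (suc d) (inj₂ w) = refl

  -- Carries comparisons in the union back to the stage, where `Y-decreasing` and `β≢val` are
  -- stated. Rank refutes the impossible cases.
  toK-reflects-≤ : ∀ d u v → toK n d u ≤ toK n d v → Stage._≤_ (stage n d) u v
  toK-reflects-≤ (suc d) (inj₁ u) (inj₁ v) u≤v = toK-reflects-≤ d u v u≤v
  toK-reflects-≤ (suc d) (inj₁ u) (inj₂ w) (inj₁ (u′ , u′∈Y , u≈u′)) =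
    Y-decreasing w (toK-reflects-≤ d u u′ (inj₂ u≈u′)) u′∈Y
  toK-reflects-≤ (suc d) (inj₁ u) (inj₂ w) (inj₂ u≈w) =
    contradiction (rank-toK< d u) (ℕₚ.<-irrefl (≈⇒rank≡ u≈w))
  toK-reflects-≤ (suc d) (inj₂ w) (inj₁ v) w≤v =
    contradiction (rank-toK< d v) (ℕₚ.≤⇒≯ (≤⇒rank≤ w≤v))
  toK-reflects-≤ (suc d) (inj₂ w) (inj₂ w′) (inj₁ w∈Y) =
    contradiction (∈Y⇒rank< (d , w′) w∈Y) (ℕₚ.<-irrefl refl)
  toK-reflects-≤ (suc d) (inj₂ w) (inj₂ w′) (inj₂ (same e)) = e

  -- `≺` works up to `≈`, while the Boolean `Y` tests stage elements themselves. They match because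
  -- equal points are comparable and `Y` is decreasing.
  Y⇔∈Y : ∀ w u → T (Y (proj₂ w) u) ⇔ toK n (proj₁ w) u ≺ w
  Y⇔∈Y (d , w) u = mk⇔ (λ u∈Y → u , u∈Y , ≈.refl)
    λ (u′ , u′∈Y , e) → Y-decreasing w (toK-reflects-≤ d u u′ (inj₂ e)) u′∈Y

  -- The condition Y ⊈ K_n^{d-2} makes the rank of (β , Y) a function of Y.
  ∈Y-⊆⇒rank≤ : ∀ w v → (∀ x → x ≺ w → x ≺ v) → rank n w ℕ.≤ rank n v
  ∈Y-⊆⇒rank≤ (zero , w) v Y⊆ = ℕ.z≤n
  ∈Y-⊆⇒rank≤ (suc d , w) v Y⊆ = ℕₚ.≮⇒≥ λ v<1+d → Y-new w λ
    { (inj₁ u) _ → u , refl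
    ; (inj₂ p) p∈Y → contradiction
        (∈Y⇒rank< v (Y⊆ (d , p) (to (Y⇔∈Y (suc d , w) (inj₂ p)) p∈Y))) (ℕₚ.≤⇒≯ (ℕ.s≤s⁻¹ v<1+d)) }

  -- Equal lower sets force equal ranks by `∈Y-⊆⇒rank≤`; the two Boolean sets then live on one stage
  -- and can be compared there.
  K-extensional : ∀ w v → (∀ x → x ≺ w ⇔ x ≺ v) → val n w ≡ val n v → w ≈ v
  K-extensional (d , w) (d′ , v) Y≡ β≡
    with ℕₚ.≤-antisym (∈Y-⊆⇒rank≤ (d , w) (d′ , v) (to ∘ Y≡))
                      (∈Y-⊆⇒rank≤ (d′ , v) (d , w) (from ∘ Y≡))
  ... | refl = same (β≡ , λ u → T-injective
                 (⇔-sym (Y⇔∈Y (d , v) u) ⇔-∘ (Y≡ (toK n d u) ⇔-∘ Y⇔∈Y (d , w) u)))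

  -- Condition (iii) of the recursion, transported from the stage to `K n`: the hypotheses say that
  -- `w` generates the set Y of `v`.
  val≢generator : ∀ w v → w ≺ v → (∀ x → x ≺ v → x ≤ w) → val n v ≢ val n w
  val≢generator w (d , v) w∈Y@(u , u∈Y , w≈u) Y≤w val≡ = β≢val v u
    (λ u′ → mk⇔
      (λ u′∈Y → toK-reflects-≤ d u′ u
        (≤-trans (Y≤w (toK n d u′) (to (Y⇔∈Y (d , v) u′) u′∈Y)) (inj₂ w≈u)))
      (λ u′≤u → Y-decreasing v u′≤u u∈Y))
    (trans val≡ (trans (≈⇒val≡ w≈u) (val-toK d u)))

  module _ (em : ∀ {ℓ} → ExcludedMiddle ℓ) where

    -- Points of rank d are told apart by val and by the points of lower rank in Y.
    enumerate : ∀ d → ∃ λ (ws : List (∣K∣ n)) → ∀ x → rank n x ℕ.< d → Any (x ≈_) ws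
    enumerate zero    = [] , λ _ ()
    enumerate (suc d) = let ws , complete = enumerate d
                            net , covers = finiteNet em (tests ws) in
      ws ++ map (d ,_) net , λ
        { (e , w) e<1+d → case ℕₚ.m≤n⇒m<n∨m≡n (ℕ.s≤s⁻¹ e<1+d) of λ
          { (inj₁ e<d)  → Anyₚ.++⁺ˡ (complete (e , w) e<d)
          ; (inj₂ refl) → Anyₚ.++⁺ʳ ws (Anyₚ.map⁺ (Any.map (agree⇒≈ complete) (covers w))) } }
      where
      tests : List (∣K∣ n) → List (Pred (Point n (stage n d)) 0ℓ)
      tests ws = map (λ i w → i Sub.∈ β w) (allFin n) ++ map (λ x w → x ≺ (d , w)) ws

      agree⇒≈ : ∀ {ws} → (∀ x → rank n x ℕ.< d → Any (x ≈_) ws) →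
                ∀ {w v} → AgreeOn em (tests ws) w v → (d , w) ≈ (d , v)
      agree⇒≈ {ws} complete {w} {v} agree = K-extensional (d , w) (d , v)
        (λ x → mk⇔ (λ x∈w → transfer x (∈Y⇒rank< (d , w) x∈w) .to x∈w)
                   (λ x∈v → transfer x (∈Y⇒rank< (d , v) x∈v) .from x∈v))
        (Subₚ.⊆-antisym (λ {i} → to (onVal i)) (λ {i} → from (onVal i)))
        where
        split = Allₚ.++⁻ (map (λ i w → i Sub.∈ β w) (allFin n)) agree
        onVal : ∀ i → i Sub.∈ β w ⇔ i Sub.∈ β v
        onVal i = All.lookup (Allₚ.map⁻ (proj₁ split)) (∈-allFin i)
        transfer : ∀ x → rank n x ℕ.< d → x ≺ (d , w) ⇔ x ≺ (d , v)
        transfer x x<d = let y , y∈ws , x≈y = find (complete x x<d)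
                             y⇔ = All.lookup (Allₚ.map⁻ (proj₂ split)) y∈ws in
          mk⇔ (∈Y-respˡ (d , v) x≈y ∘ to y⇔ ∘ ∈Y-respˡ (d , w) (≈.sym x≈y))
              (∈Y-respˡ (d , w) x≈y ∘ from y⇔ ∘ ∈Y-respˡ (d , v) (≈.sym x≈y))

    -- Definability by de Jongh's formulas

    -- Phrased for predicates up to pointwise equivalence, so that formulas can be handled through
    -- their meaning at each point.
    Definable : Pred (∣K∣ n) 0ℓ → Set₁
    Definable Q = ∃ λ z → z ∈ F em n × (∀ v → v ∈ set z ⇔ v ∈ Q)

    definable-resp : ∀ {Q R} → (∀ v → v ∈ Q ⇔ v ∈ R) → Definable Q → Definable R
    definable-resp Q⇔R (z , z∈F , z⇔) = z , z∈F , λ v → Q⇔R v ⇔-∘ z⇔ v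

    -- Classically, a proposition independent of the point is top or bottom. This lets side
    -- conditions such as P ∉ β occur inside a formula.
    definable-const : ∀ (A : Set) → Definable (λ _ → A)
    definable-const A with em {P = A}
    ... | yes a = _ , top , λ v → mk⇔ (λ _ → a) (λ _ → tt)
    ... | no ¬a = _ , bot , λ v → mk⇔ (λ ()) ¬a

    definable-val : ∀ i → Definable (λ v → i Sub.∈ val n v)
    definable-val i = g n i , gen i , λ v → ⇔-id _

    definable-∩ : ∀ {Q R} → Definable Q → Definable R → Definable (Q ∩ R)
    definable-∩ (x , x∈F , x⇔) (y , y∈F , y⇔) = _ , meet x∈F y∈F , λ v →
      mk⇔ (λ (p , q) → to (x⇔ v) p , to (y⇔ v) q) (λ (p , q) → from (x⇔ v) p , from (y⇔ v) q)

    definable-∪ : ∀ {Q R} → Definable Q → Definable R → Definable (Q ∪ R)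
    definable-∪ (x , x∈F , x⇔) (y , y∈F , y⇔) = _ , join x∈F y∈F , λ v →
      mk⇔ (⊎.map (to (x⇔ v)) (to (y⇔ v))) (⊎.map (from (x⇔ v)) (from (y⇔ v)))

    -- The Kripke reading of `⇨`: excluded middle at `u` turns an implication into membership in the
    -- union `∁ (set x) ∪ set y`.
    definable-⇒ : ∀ {Q R} → Definable Q → Definable R →
                  Definable (λ v → ∀ u → u ≤ v → u ∈ Q → u ∈ R)
    definable-⇒ {Q} {R} (x , x∈F , x⇔) (y , y∈F , y⇔) = _ , imp x∈F y∈F , λ v →
      mk⇔ (λ v∈ u u≤v u∈Q → apply u (v∈ u≤v) u∈Q) (λ f {u} u≤v → split u (f u u≤v))
      where
      apply : ∀ u → u ∈ (∁ (set x) ∪ set y) → u ∈ Q → u ∈ R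
      apply u (inj₁ u∉x) u∈Q = contradiction (from (x⇔ u) u∈Q) u∉x
      apply u (inj₂ u∈y) _   = to (y⇔ u) u∈y

      split : ∀ u → (u ∈ Q → u ∈ R) → u ∈ (∁ (set x) ∪ set y)
      split u f with em {P = u ∈ set x}
      ... | yes u∈x = inj₂ (from (y⇔ u) (f (to (x⇔ u) u∈x)))
      ... | no  u∉x = inj₁ u∉x

    -- Definability of `Q` is asked for only under `A`, so that in the recursion on rank the
    -- assumption `y ≺ w` can justify the recursive call.
    definable-when : ∀ {A : Set} {Q} → (A → Definable Q) → Definable (λ v → A × v ∈ Q)
    definable-when {A} def with em {P = A}
    ... | yes a = definable-∩ (definable-const A) (def a)
    ... | no ¬a = definable-resp (λ v → mk⇔ (λ a → contradiction a ¬a) proj₁) (definable-const A)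

    definable-Any : ∀ {I : Set} {Q : I → Pred (∣K∣ n) 0ℓ} → (∀ i → Definable (Q i)) →
                    ∀ is → Definable (λ v → Any (λ i → v ∈ Q i) is)
    definable-Any def []       = _ , bot , λ v → mk⇔ (λ ()) (λ ())
    definable-Any def (i ∷ is) = definable-resp (λ v → mk⇔ Any.fromSum Any.toSum)
      (definable-∪ (def i) (definable-Any def is))

    definable-All : ∀ {I : Set} {Q : I → Pred (∣K∣ n) 0ℓ} → (∀ i → Definable (Q i)) →
                    ∀ is → Definable (λ v → All (λ i → v ∈ Q i) is)
    definable-All def []       = _ , top , λ v → mk⇔ (λ _ → []) (λ _ → tt)
    definable-All def (i ∷ is) = definable-resp (λ v → mk⇔ (λ (q , qs) → q ∷ qs) All.uncons)
      (definable-∩ (def i) (definable-All def is))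

    -- The antecedent of the implication in de Jongh's formula for `w`. A point outside it has its
    -- valuation contained in that of `w` and lies above all of Y.
    Separated : ∣K∣ n → Pred (∣K∣ n) 0ℓ
    Separated w u = Any (λ i → i Sub.∉ val n w × i Sub.∈ val n u) (allFin n)
                  ⊎ (∃ λ y → y ≺ w × ¬ y ≤ u)

    -- If v ∉ Y, where w = w_{β,Y}, then v is not separated from w, so val v = β and Y lies
    -- below v.  By induction everything strictly below v is ≤ w; it is all in Y, and v ≈ w,
    -- unless w < v, which condition (iii) excludes for v.
    below-characterisation : ∀ w v → Acc ℕ._<_ (rank n v) → val n w Sub.⊆ val n v →
      (∀ u → u ≤ v → u ∈ Separated w → u ≺ w) → v ≤ w
    below-characterisation w v (acc rec) w⊆v sep⇒≺ with em {P = v ≺ w} | em {P = w ≺ v}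
    ... | yes v≺w | _ = inj₁ v≺w
    ... | no  v⊀w | w≺v? = conclude w≺v?
      where
      v-inseparable : ¬ (v ∈ Separated w)
      v-inseparable = v⊀w ∘ sep⇒≺ v ≤-refl

      val≡ : val n v ≡ val n w
      val≡ = Subₚ.⊆-antisym
        (λ {i} i∈v → em⇒dne em λ i∉w → v-inseparable (inj₁ (lose (∈-allFin i) (i∉w , i∈v)))) w⊆v

      ≺w⇒≺v : ∀ x → x ≺ w → x ≺ v
      ≺w⇒≺v x x≺w with em⇒dne em {P = x ≤ v} (λ x≰v → v-inseparable (inj₂ (x , x≺w , x≰v)))
      ... | inj₁ x≺v = x≺v
      ... | inj₂ x≈v = contradiction (∈Y-respˡ w (≈.sym x≈v) x≺w) v⊀w

      ≺v⇒≤w : ∀ x → x ≺ v → x ≤ w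
      ≺v⇒≤w x x≺v = below-characterisation w x (rec (∈Y⇒rank< v x≺v))
        (λ {i} i∈w → decreasing (g n i) {x} {v} (inj₁ x≺v) (w⊆v i∈w))
        (λ u u≤x → sep⇒≺ u (≤-trans {k = v} u≤x (inj₁ x≺v)))

      conclude : Dec (w ≺ v) → v ≤ w
      conclude (yes w≺v) = contradiction val≡ (val≢generator w v w≺v ≺v⇒≤w)
      conclude (no  w⊀v) = inj₂ (K-extensional v w (λ x → mk⇔ (≺v⇒≺w x) (≺w⇒≺v x)) val≡)
        where
        ≺v⇒≺w : ∀ x → x ≺ v → x ≺ w
        ≺v⇒≺w x x≺v with ≺v⇒≤w x x≺v
        ... | inj₁ x≺w = x≺w
        ... | inj₂ x≈w = contradiction (∈Y-respˡ v (≈.sym x≈w) x≺v) w⊀v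

    -- De Jongh's formulas: for w = w_{β,Y}, the set {v | v ≤ w} is
    -- ⋀_{P∈β} P ∧ ((⋁_{P∉β} P ∨ ⋁_{y∈Y} {u | y ≰ u}) → Y), and {v | w ≰ v} is {v | v ≤ w} → Y.
    cones-definable : ∀ w → Acc ℕ._<_ (rank n w) → Definable (_≤ w) × Definable (λ v → ¬ w ≤ v)
    cones-definable w (acc rec) = ≤w-definable , w≰-definable
      where
      -- Points `y ≺ w` have smaller rank than `w`, so the quantifier is a finite disjunction over
      -- an enumeration. That enumeration is complete only up to `≈`, whence `Q-resp`.
      definable-∃≺w : {Q : ∣K∣ n → Pred (∣K∣ n) 0ℓ} →
                      (∀ {y z v} → y ≈ z → v ∈ Q y → v ∈ Q z) →
                      (∀ y → y ≺ w → Definable (Q y)) →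
                      Definable (λ v → ∃ λ y → y ≺ w × v ∈ Q y)
      definable-∃≺w {Q} Q-resp def =
        let ws , complete = enumerate (rank n w) in
        definable-resp
          (λ v → mk⇔
            (λ p → let y , _ , q = find p in y , q)
            (λ (y , y≺w , v∈Qy) → let z , z∈ws , y≈z = find (complete y (∈Y⇒rank< w y≺w)) in
              lose z∈ws (∈Y-respˡ w (≈.sym y≈z) y≺w , Q-resp y≈z v∈Qy)))
          (definable-Any {Q = λ y v → y ≺ w × v ∈ Q y} (λ y → definable-when (def y)) ws)

      ≺w-definable : Definable (_≺ w)
      ≺w-definable = definable-resp
        (λ v → mk⇔ (λ (y , y≺w , v≤y) → ≤-∈Y w v≤y y≺w) (λ v≺w → v , v≺w , ≤-refl))
        (definable-∃≺w {Q = λ y v → v ≤ y} (λ {_} {_} {v} y≈z v≤y → ≤-trans {i = v} v≤y (inj₂ y≈z))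
          (λ y y≺w → proj₁ (cones-definable y (rec (∈Y⇒rank< w y≺w)))))

      separated-definable : Definable (Separated w)
      separated-definable = definable-∪
        (definable-Any (λ i → definable-when λ _ → definable-val i) (allFin n))
        (definable-∃≺w {Q = λ y v → ¬ y ≤ v}
          (λ {y} {z} y≈z y≰v z≤v → y≰v (≤-trans {j = z} (inj₂ y≈z) z≤v))
          (λ y y≺w → proj₂ (cones-definable y (rec (∈Y⇒rank< w y≺w)))))

      separated⇒≺ : ∀ u → u ≤ w → u ∈ Separated w → u ≺ w
      separated⇒≺ u (inj₁ u≺w) _ = u≺w
      separated⇒≺ u (inj₂ u≈w) (inj₁ p) = let i , _ , i∉w , i∈u = find p in
        contradiction (subst (i Sub.∈_) (≈⇒val≡ u≈w) i∈u) i∉w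
      separated⇒≺ u (inj₂ u≈w) (inj₂ (y , y≺w , y≰u)) =
        contradiction (inj₁ (∈Y-respʳ w y≺w (≈.sym u≈w))) y≰u

      ≤w-definable : Definable (_≤ w)
      ≤w-definable = definable-resp
        (λ v → mk⇔
          (λ (w⊆v , sep⇒≺) → below-characterisation w v (<-wellFounded _)
            (λ {i} i∈w → let w∌i⊎i∈v = All.lookup w⊆v (∈-allFin i) in
               ⊎.fromInj₂ (contradiction i∈w) w∌i⊎i∈v) sep⇒≺)
          (λ v≤w → All.universal (λ i → val-⊆ v v≤w i) _ ,
                   λ u u≤v → separated⇒≺ u (≤-trans {j = v} u≤v v≤w)))
        (definable-∩
          (definable-All
            (λ i → definable-∪ (definable-const (i Sub.∉ val n w)) (definable-val i)) (allFin n))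
          (definable-⇒ separated-definable ≺w-definable))
        where
        val-⊆ : ∀ v → v ≤ w → ∀ i → i Sub.∉ val n w ⊎ i Sub.∈ val n v
        val-⊆ v v≤w i with i Subₚ.∈? val n w
        ... | yes i∈w = inj₂ (decreasing (g n i) {v} {w} v≤w i∈w)
        ... | no  i∉w = inj₁ i∉w

      w≰-definable : Definable (λ v → ¬ w ≤ v)
      w≰-definable = definable-resp
        (λ v → mk⇔
          -- At `u = w` the implication would give `w ≺ w`, against the rank.
          (λ f w≤v → contradiction (∈Y⇒rank< w (f w w≤v ≤-refl)) (ℕₚ.<-irrefl refl))
          (λ w≰v u u≤v → λ
            { (inj₁ u≺w) → u≺w
            ; (inj₂ u≈w) → contradiction (≤-trans {j = u} (inj₂ (≈.sym u≈w)) u≤v) w≰v }))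
        (definable-⇒ ≤w-definable ≺w-definable)

    -- `z` is the union of the cones below those points of `x` that have rank at most `d`, finitely
    -- many up to `≈`.
    definable-up-to-rank : ∀ d (x : DownSet (K n)) → ∃ λ z → z ∈ F em n ×
                           (∀ v → rank n v ℕ.≤ d → v ∈ set z ⇔ v ∈ set x)
    definable-up-to-rank d x =
      -- `enumerate` takes a strict bound on the rank, hence `suc d`.
      let ws , complete = enumerate (suc d)
          z , z∈F , z⇔  = definable-Any {Q = λ w v → w ∈ set x × v ≤ w} (λ w → definable-when λ _ →
                            proj₁ (cones-definable w (<-wellFounded _))) ws
      in z , z∈F , λ v v≤d → mk⇔
           (λ p → let w , _ , w∈x , v≤w = find (to (z⇔ v) p) in decreasing x v≤w w∈x)
           (λ v∈x → let w , w∈ws , v≈w = find (complete v (ℕ.s≤s v≤d)) in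
              from (z⇔ v) (lose w∈ws (decreasing x (inj₂ (≈.sym v≈w)) v∈x , inj₂ v≈w)))

-- The metric space

module _ (em : ∀ {ℓ} → ExcludedMiddle ℓ) where

  -- Indexed by the value, so that matching replaces a distance by 0 or by a power of two and at the
  -- same time reveals which levels disagree.
  data 2^-min-View (Q : Pred ℕ 0ℓ) : ℚ → Set where
    empty : (∀ i → i ∉ Q) → 2^-min-View Q 0ℚ
    least : ∀ i → IsMin Q i → 2^-min-View Q (2^- i)

  2^-min-view : ∀ Q → 2^-min-View Q (2^-min_ em Q)
  2^-min-view Q with em {P = ∃ Q}
  ... | yes ne = least _ (proj₂ (min em Q ne))
  ... | no ∄i  = empty λ i i∈Q → ∄i (i , i∈Q)

  2^-min-cong : ∀ {Q R : Pred ℕ 0ℓ} → Q ⊆ R → R ⊆ Q → 2^-min_ em Q ≡ 2^-min_ em R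
  2^-min-cong {Q} {R} Q⊆R R⊆Q
    with 2^-min_ em Q | 2^-min-view Q | 2^-min_ em R | 2^-min-view R
  ... | _ | empty _           | _ | empty _           = refl
  ... | _ | empty ∉Q          | _ | least i (i∈R , _) = contradiction (R⊆Q i∈R) (∉Q i)
  ... | _ | least i (i∈Q , _) | _ | empty ∉R          = contradiction (Q⊆R i∈Q) (∉R i)
  ... | _ | least i (i∈Q , i≤) | _ | least j (j∈R , j≤) =
    cong 2^-_ (ℕₚ.≤-antisym (i≤ j (R⊆Q j∈R)) (j≤ i (Q⊆R i∈Q)))

  0≤2^-min : ∀ Q → 0ℚ ℚ.≤ 2^-min_ em Q
  0≤2^-min Q with 2^-min_ em Q | 2^-min-view Q
  ... | _ | empty _   = ℚₚ.≤-refl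
  ... | _ | least i _ = ℚₚ.<⇒≤ (0<2^- i)

  module _ (n : ℕ) where

    open HeytingAlgebra (F̂ em n) using (Carrier; _≈_; _∧_; _∨_; _⇨_; isEquivalence)

    Agree : ℕ → Carrier → Carrier → Set
    Agree i x y = HeytingAlgebra._≈_ (𝒪↓ em (K^ n i)) (π̂ n i x) (π̂ n i y)

    agree-intro : ∀ {i} x y → (∀ v → rank n v ℕ.≤ i → v ∈ set x ⇔ v ∈ set y) → Agree i x y
    agree-intro x y x⇔y = (λ {(v , v≤i)} → to (x⇔y v v≤i)) , (λ {(v , v≤i)} → from (x⇔y v v≤i))

    agree-elim : ∀ {i} x y → Agree i x y → ∀ v → rank n v ℕ.≤ i → v ∈ set x ⇔ v ∈ set y
    agree-elim x y (x⊆y , y⊆x) v v≤i = mk⇔ (x⊆y {v , v≤i}) (y⊆x {v , v≤i})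

    agree-refl : ∀ {i} x → Agree i x x
    agree-refl x = id , id

    agree-sym : ∀ {i} x y → Agree i x y → Agree i y x
    agree-sym x y (f , g) = (λ {v} → g {v}) , (λ {v} → f {v})

    agree-trans : ∀ {i} x y z → Agree i x y → Agree i y z → Agree i x z
    agree-trans x y z (f , g) (h , k) = (λ {v} p → h {v} (f {v} p)) , (λ {v} p → g {v} (k {v} p))

    agree-anti : ∀ {i j} x y → i ℕ.≤ j → Agree j x y → Agree i x y
    agree-anti x y i≤j x~y = agree-intro x y λ v v≤i → agree-elim x y x~y v (ℕₚ.≤-trans v≤i i≤j)

    ≈⇒agree : ∀ {i} x y → x ≈ y → Agree i x y
    ≈⇒agree x y (f , g) = f , g

    -- Every point `v` already lies in K_n^i for `i = rank n v`, so that level settles its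
    -- membership.
    agree⇒≈ : ∀ x y → (∀ i → Agree i x y) → x ≈ y
    agree⇒≈ x y x~y = (λ {v} → to (pointwise v)) , (λ {v} → from (pointwise v))
      where
      pointwise : ∀ v → v ∈ set x ⇔ v ∈ set y
      pointwise v = agree-elim x y (x~y (rank n v)) v ℕₚ.≤-refl

    private
      d = dist em n
      Disagree = λ x y i → ¬ Agree i x y

    -- Agreement at level `i` passes to all smaller levels, so a least disagreement comes strictly
    -- after `i`. With `dist<⇒agree`, the open balls of radius `2^- i` are exactly the classes of
    -- `Agree i`.
    agree⇒dist< : ∀ i x y → Agree i x y → d x y ℚ.< 2^- i
    agree⇒dist< i x y x~y with 2^-min_ em (Disagree x y) | 2^-min-view (Disagree x y)
    ... | _ | empty _         = 0<2^- i
    ... | _ | least j (x≁y , _) = 2^-anti-< (ℕₚ.≰⇒> λ j≤i → x≁y (agree-anti x y j≤i x~y))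

    disagree⇒≤dist : ∀ i x y → ¬ Agree i x y → 2^- i ℚ.≤ d x y
    disagree⇒≤dist i x y x≁y with 2^-min_ em (Disagree x y) | 2^-min-view (Disagree x y)
    ... | _ | empty x~y         = contradiction x≁y (x~y i)
    ... | _ | least j (_ , j≤) = 2^-anti-≤ (j≤ i x≁y)

    dist<⇒agree : ∀ i x y → d x y ℚ.< 2^- i → Agree i x y
    dist<⇒agree i x y d<2^-i = em⇒dne em λ x≁y →
      ℚₚ.<-irrefl refl (ℚₚ.<-≤-trans d<2^-i (disagree⇒≤dist i x y x≁y))

    dist-cong : ∀ {x x′ y y′} → (∀ {i} → Agree i x y ⇔ Agree i x′ y′) → d x y ≡ d x′ y′
    dist-cong e = 2^-min-cong (_∘ from e) (_∘ to e)

    -- If `x` and `z` first disagree at `i`, transitivity of `Agree i` forces `x, y` or `y, z` to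
    -- disagree there. That one distance is already at least `2^- i`.
    dist-triangle : ∀ x y z → d x z ℚ.≤ d x y ℚ.+ d y z
    dist-triangle x y z with 2^-min_ em (Disagree x z) | 2^-min-view (Disagree x z)
    ... | _ | empty _ = ℚₚ.+-mono-≤ (0≤2^-min (Disagree x y)) (0≤2^-min (Disagree y z))
    ... | _ | least i (x≁z , _) with em {P = Agree i x y}
    ...   | no x≁y = begin
      2^- i             ≡⟨ ℚₚ.+-identityʳ _ ⟨
      2^- i ℚ.+ 0ℚ      ≤⟨ ℚₚ.+-mono-≤ (disagree⇒≤dist i x y x≁y) (0≤2^-min (Disagree y z)) ⟩
      d x y ℚ.+ d y z   ∎
      where open ℚₚ.≤-Reasoning
    ...   | yes x~y = begin
      2^- i             ≡⟨ ℚₚ.+-identityˡ _ ⟨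
      0ℚ ℚ.+ 2^- i      ≤⟨ ℚₚ.+-mono-≤ (0≤2^-min (Disagree x y))
                             (disagree⇒≤dist i y z λ y~z → x≁z (agree-trans x y z x~y y~z)) ⟩
      d x y ℚ.+ d y z   ∎
      where open ℚₚ.≤-Reasoning

    dist-isMetric : IsMetric _≈_ d
    dist-isMetric = record
      { isSemiMetric = record
        { isQuasiSemiMetric = record
          { isPreMetric = record
            { isProtoMetric = record
              { isPartialOrder  = ℚₚ.≤-isPartialOrder
              ; ≈-isEquivalence = isEquivalence
              ; cong            = λ {x} {y} {u} {v} x≈y u≈v → dist-cong {x} {y} {u} {v}
                  (mk⇔ (λ x~u → agree-trans y x v (agree-sym x y (≈⇒agree x y x≈y))
                                  (agree-trans x u v x~u (≈⇒agree u v u≈v)))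
                       (λ y~v → agree-trans x y u (≈⇒agree x y x≈y)
                                  (agree-trans y v u y~v (agree-sym u v (≈⇒agree u v u≈v)))))
              ; nonNegative     = λ {x} {y} → 0≤2^-min (Disagree x y)
              }
            ; ≈⇒0 = λ {x} {y} x≈y → ≈⇒dist≡0 x y x≈y
            }
          -- Distance 0 is below every `2^- i`, so the traces agree at all levels.
          ; 0⇒≈ = λ {x} {y} d≡0 → agree⇒≈ x y λ i →
              dist<⇒agree i x y (subst (ℚ._< 2^- i) (sym d≡0) (0<2^- i))
          }
        ; sym = λ x y → dist-cong {x} {y} {y} {x} (mk⇔ (agree-sym x y) (agree-sym y x))
        }
      ; triangle = dist-triangle
      }
      where
      ≈⇒dist≡0 : ∀ x y → x ≈ y → d x y ≡ 0ℚ
      ≈⇒dist≡0 x y x≈y with 2^-min_ em (Disagree x y) | 2^-min-view (Disagree x y)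
      ... | _ | empty _           = refl
      ... | _ | least i (x≁y , _) = contradiction (≈⇒agree x y x≈y) x≁y

    -- The metric topology and the profinite topology

    module _ {ℓ : Level} where

      𝒯 : Topology Carrier ℓ _
      𝒯 = MetricTopology d

      Neighbourhood : Pred Carrier ℓ → Carrier → Set _
      Neighbourhood U x = ∃ λ i → ∀ y → Agree i x y → y ∈ U

      -- Replaces rational radii by levels: some `2^- i` lies below the given ε.
      open⇒neighbourhood : ∀ U → U ∈ 𝒯 → ∀ x → x ∈ U → Neighbourhood U x
      open⇒neighbourhood U U-open x x∈U =
        let ε , 0<ε , ball⊆U = U-open x∈U
            i , 2^-i<ε       = 2^-archimedean ε 0<ε
        in i , λ y x~y → ball⊆U (ℚₚ.<-trans (agree⇒dist< i x y x~y) 2^-i<ε)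

      neighbourhood⇒open : ∀ U → (∀ x → x ∈ U → Neighbourhood U x) → U ∈ 𝒯
      neighbourhood⇒open U nbhd {x} x∈U = let i , ⊆U = nbhd x x∈U in
        2^- i , 0<2^- i , λ {y} d<2^-i → ⊆U y (dist<⇒agree i x y d<2^-i)

      -- A record, so that `Agree i x`, which lives at level 0, becomes a predicate at the level `ℓ`
      -- of the topology.
      record Cylinder (i : ℕ) (x y : Carrier) : Set ℓ where
        constructor within
        field agrees : Agree i x y

      cylinder-open : ∀ i x → Cylinder i x ∈ 𝒯
      cylinder-open i x = neighbourhood⇒open (Cylinder i x) λ y (within x~y) →
        i , λ z y~z → within (agree-trans x y z x~y y~z)

      -- Unequal elements disagree at some level, and the cylinders of that level are equivalence
      -- classes, hence equal or disjoint.
      𝒯-hausdorff : Hausdorff _≈_ 𝒯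
      𝒯-hausdorff x y x≉y with em {P = ∃ λ i → ¬ Agree i x y}
      ... | no ∄i = contradiction (agree⇒≈ x y λ i → em⇒dne em λ x≁y → ∄i (i , x≁y)) x≉y
      ... | yes (i , x≁y) =
        Cylinder i x , Cylinder i y , cylinder-open i x , cylinder-open i y ,
        within (agree-refl x) , within (agree-refl y) ,
        λ z (within x~z , within y~z) → x≁y (agree-trans x z y x~z (agree-sym y z y~z))

      private
        module _ (i : ℕ) where
          open HeytingAlgebra (𝒪↓ em (K^ n i)) public
            using () renaming (_≈_ to _≈ᵢ_; isEquivalence to ≈ᵢ-isEquivalence)

      -- One subbasic set suffices: a cylinder is the preimage under `π̂ n i` of a single class of
      -- the discrete target.
      open⇒profinite : ∀ U → U ∈ 𝒯 → U ∈ ProfiniteTopology em n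
      open⇒profinite U U-open {x} x∈U =
        let i , ⊆U = open⇒neighbourhood U U-open x x∈U in
        (i , (λ a → Lift ℓ (_≈ᵢ_ i (π̂ n i x) a)) ,
             λ {a} {b} a≈b (lift x≈a) →
               lift (IsEquivalence.trans (≈ᵢ-isEquivalence i) {π̂ n i x} {a} {b} x≈a a≈b)) ∷ [] ,
        lift (agree-refl x) ∷ [] ,
        λ { {z} (lift x~z ∷ []) → ⊆U z x~z }

      -- Finitely many conditions on traces depend only on the trace at the largest level involved;
      -- the empty intersection takes level 0.
      subbasic-neighbourhood : ∀ x →
        (Vs : List (Σ ℕ λ i → ∃ λ (V : Pred (DownSet (K^ n i)) ℓ) → V ∈ Discrete (_≈ᵢ_ i))) →
        All (λ (i , V , _) → π̂ n i x ∈ V) Vs →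
        ∃ λ i → ∀ z → Agree i x z → All (λ (i , V , _) → π̂ n i z ∈ V) Vs
      subbasic-neighbourhood x [] [] = 0 , λ _ _ → []
      subbasic-neighbourhood x ((i , V , V-resp) ∷ Vs) (x∈V ∷ x∈Vs) =
        let j , ⊆Vs = subbasic-neighbourhood x Vs x∈Vs in
        i ℕ.⊔ j , λ z x~z →
          V-resp (agree-anti x z (ℕₚ.m≤m⊔n i j) x~z) x∈V ∷
          ⊆Vs z (agree-anti x z (ℕₚ.m≤n⊔m i j) x~z)

      profinite⇒open : ∀ U → U ∈ ProfiniteTopology em n → U ∈ 𝒯
      profinite⇒open U U-profinite = neighbourhood⇒open U λ x x∈U →
        let Vs , x∈Vs , Vs⊆U = U-profinite x∈U
            i , ⊆Vs          = subbasic-neighbourhood x Vs x∈Vs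
        in i , λ z x~z → Vs⊆U {z} (⊆Vs z x~z)

      -- Such an `f` acts on the traces at each level separately, so the level found for the value
      -- serves for both arguments.
      levelwise⇒continuous : (f : Carrier → Carrier → Carrier) →
        (∀ i {x x′ y y′} → Agree i x x′ → Agree i y y′ → Agree i (f x y) (f x′ y′)) →
        Continuous (𝒯 ⊗ 𝒯) 𝒯 (uncurry f)
      levelwise⇒continuous f f-levelwise V V-open {x} {y} fxy∈V =
        let i , ⊆V = open⇒neighbourhood V V-open (f x y) fxy∈V in
        Cylinder i x , Cylinder i y , cylinder-open i x , cylinder-open i y ,
        within (agree-refl x) , within (agree-refl y) ,
        λ {x′} {y′} (within x~x′) (within y~y′) →
          ⊆V (f x′ y′) (f-levelwise i {x} {x′} {y} {y′} x~x′ y~y′)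

    -- Compatibility of the Heyting operations with traces

    ∧-agree : ∀ i {x x′ y y′} → Agree i x x′ → Agree i y y′ → Agree i (x ∧ y) (x′ ∧ y′)
    ∧-agree i {x} {x′} {y} {y′} x~x′ y~y′ = agree-intro (x ∧ y) (x′ ∧ y′) λ v v≤i →
      let x⇔x′ = agree-elim x x′ x~x′ v v≤i
          y⇔y′ = agree-elim y y′ y~y′ v v≤i
      in mk⇔ (λ (p , q) → to x⇔x′ p , to y⇔y′ q) (λ (p , q) → from x⇔x′ p , from y⇔y′ q)

    ∨-agree : ∀ i {x x′ y y′} → Agree i x x′ → Agree i y y′ → Agree i (x ∨ y) (x′ ∨ y′)
    ∨-agree i {x} {x′} {y} {y′} x~x′ y~y′ = agree-intro (x ∨ y) (x′ ∨ y′) λ v v≤i →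
      let x⇔x′ = agree-elim x x′ x~x′ v v≤i
          y⇔y′ = agree-elim y y′ y~y′ v v≤i
      in mk⇔ (⊎.map (to x⇔x′) (to y⇔y′)) (⊎.map (from x⇔x′) (from y⇔y′))

    -- Membership of `v` in an implication depends only on points `u ≤ v`, and these have rank at
    -- most that of `v`: K_n^i is decreasing in K_n.
    ⇨-agree : ∀ i {x x′ y y′} → Agree i x x′ → Agree i y y′ → Agree i (x ⇨ y) (x′ ⇨ y′)
    ⇨-agree i {x} {x′} {y} {y′} x~x′ y~y′ = agree-intro (x ⇨ y) (x′ ⇨ y′) λ v v≤i →
      mk⇔ (λ v∈ {u} u≤v → let u≤i = ℕₚ.≤-trans (≤⇒rank≤ n u≤v) v≤i in
             ⊎.map (_∘ from (agree-elim x x′ x~x′ u u≤i))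
                   (to (agree-elim y y′ y~y′ u u≤i)) (v∈ u≤v))
          (λ v∈ {u} u≤v → let u≤i = ℕₚ.≤-trans (≤⇒rank≤ n u≤v) v≤i in
             ⊎.map (_∘ to (agree-elim x x′ x~x′ u u≤i))
                   (from (agree-elim y y′ y~y′ u u≤i)) (v∈ u≤v))

    -- Completeness and density

    limit : (s : ℕ → Carrier) → (∀ {i j} → i ℕ.≤ j → Agree i (s i) (s j)) →
            ∃ λ x → ∀ i → Agree i (s i) x
    limit s coherent = x , λ i → agree-intro (s i) x λ v v≤i → ⇔-sym (stable v v≤i)
      where
      stable : ∀ v {i} → rank n v ℕ.≤ i → v ∈ set (s (rank n v)) ⇔ v ∈ set (s i)
      stable v {i} v≤i = agree-elim (s (rank n v)) (s i) (coherent v≤i) v ℕₚ.≤-refl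
      x : Carrier
      -- A diagonal choice: from index `rank n v` on, coherence fixes whether `v` belongs to the
      -- terms.
      x .set v = v ∈ set (s (rank n v))
      x .decreasing {u} {v} u≤v v∈x =
        from (stable u (≤⇒rank≤ n u≤v)) (decreasing (s (rank n v)) u≤v v∈x)

    dist-complete : Complete d
    dist-complete s s-cauchy = let x , t~x = limit t t-coherent in x , λ ε 0<ε →
      let i , 2^-i<ε = 2^-archimedean ε 0<ε in
      N i , λ k N≤k → ℚₚ.<-trans
        (agree⇒dist< i (s k) x (agree-trans (s k) (t i) x
          (agree-sym (t i) (s k) (t~s i k N≤k)) (t~x i))) 2^-i<ε
      where
      N : ℕ → ℕ
      N i = proj₁ (s-cauchy (2^- i) (0<2^- i))
      t : ℕ → Carrier
      t i = s (N i)
      t~s : ∀ i k → N i ℕ.≤ k → Agree i (t i) (s k)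
      t~s i k N≤k = dist<⇒agree i (t i) (s k)
        (proj₂ (s-cauchy (2^- i) (0<2^- i)) (N i) k ℕₚ.≤-refl N≤k)
      t-coherent : ∀ {i j} → i ℕ.≤ j → Agree i (t i) (t j)
      -- `N` need not be monotone, so both terms are compared with one index beyond both moduli.
      t-coherent {i} {j} i≤j = let k = N i ℕ.⊔ N j in
        agree-trans (t i) (s k) (t j) (t~s i k (ℕₚ.m≤m⊔n (N i) (N j)))
          (agree-sym (t j) (s k) (agree-anti (t j) (s k) i≤j (t~s j k (ℕₚ.m≤n⊔m (N i) (N j)))))

    F-dense : ∀ y ε → 0ℚ ℚ.< ε → ∃ λ (x : ∃ (F em n)) → d (proj₁ x) y ℚ.< ε
    F-dense y ε 0<ε =
      let i , 2^-i<ε    = 2^-archimedean ε 0<ε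
          z , z∈F , z⇔y = definable-up-to-rank n em i y
      in (z , z∈F) , ℚₚ.<-trans (agree⇒dist< i z y (agree-intro z y z⇔y)) 2^-i<ε

    -- Compactness

    totallyBounded : ∀ i → ∃ λ (net : List Carrier) → ∀ x → Any (λ c → Agree i c x) net
    totallyBounded i =
      let ws , complete = enumerate n em (suc i)
          -- These tests determine the trace: `ws` is complete up to `≈`, and decreasing sets
          -- respect `≈`.
          net , covers  = finiteNet em (map (λ w (x : Carrier) → w ∈ set x) ws)
      in net , λ x → Any.map (λ {c} x~c → agree-intro c x λ v v≤i →
           let w , w∈ws , v≈w = find (complete v (ℕ.s≤s v≤i))
               x⇔c            = All.lookup (Allₚ.map⁻ x~c) w∈ws
           in mk⇔ (λ v∈c → decreasing x (inj₂ v≈w) (from x⇔c (decreasing c (inj₂ (≈.sym v≈w)) v∈c)))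
                  (λ v∈x → decreasing c (inj₂ v≈w) (to x⇔c (decreasing x (inj₂ (≈.sym v≈w)) v∈x))))
         (covers x)
      where open Poset (K n) using () renaming (module Eq to ≈)

    module _ {ℓ ι} {I : Set ι} (U : I → Pred Carrier ℓ) where

      Covered : ∀ {p} → Pred Carrier p → Set _
      Covered A = ∃ λ (is : List I) → ∀ x → x ∈ A → Any (λ i → x ∈ U i) is

      covered-⋃ : ∀ {X : Set₁} {A : X → Pred Carrier 0ℓ} → (∀ c → Covered (A c)) →
                  ∀ cs → Covered (λ x → Any (λ c → x ∈ A c) cs)
      covered-⋃ cov [] = [] , λ _ ()
      covered-⋃ cov (c ∷ cs) = let is , covers = cov c
                                   js , covers′ = covered-⋃ cov cs in
        is ++ js , λ { x (here x∈A)  → Anyₚ.++⁺ˡ (covers x x∈A)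
                     ; x (there x∈A) → Anyₚ.++⁺ʳ is (covers′ x x∈A) }

      -- If every piece of `A` had a finite subcover, joining those of the finitely many pieces from
      -- the net would cover `A`.
      split : ∀ i {A : Pred Carrier 0ℓ} → ¬ Covered A → ∃ λ c → ¬ Covered (A ∩ Agree i c)
      split i {A} ¬cov = em⇒dne em λ ∄c →
        let net , bounded = totallyBounded i
            is , covers   = covered-⋃ (λ c → em⇒dne em λ ¬c → ∄c (c , ¬c)) net
        in ¬cov (is , λ x x∈A → covers x (Any.map (x∈A ,_) (bounded x)))

      uncovered⇒nonempty : ∀ {A : Pred Carrier 0ℓ} → ¬ Covered A → ∃ A
      uncovered⇒nonempty ¬cov = em⇒dne em λ ∄x → ¬cov ([] , λ x x∈A → contradiction (x , x∈A) ∄x)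

      UncoveredAt : ℕ → Set _
      UncoveredAt i = ∃ λ c → ¬ Covered (Agree i c)

      -- The cylinder of `c` is split one level further. An uncovered piece is nonempty, and a point
      -- `z` in it agrees with both centres, which links `c` to `c′`.
      refine : ∀ {i} ((c , _) : UncoveredAt i) → ∃ λ ((c′ , _) : UncoveredAt (suc i)) → Agree i c c′
      refine {i} (c , ¬cov) =
        let c′ , ¬cov′      = split (suc i) ¬cov
            z , c~z , c′~z = uncovered⇒nonempty ¬cov′
        in (c′ , λ (is , covers) → ¬cov′ (is , λ x (_ , x∈) → covers x x∈)) ,
           agree-trans c z c′ c~z (agree-sym c′ z (agree-anti c′ z (ℕₚ.n≤1+n i) c′~z))

      -- The centres chosen by repeated refinement are coherent. Their limit agrees with the centre
      -- of index `i` at level `i`, so it has the same uncovered cylinder.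
      uncovered-limit : ¬ Covered (λ _ → ⊤) → ∃ λ x → ∀ i → ¬ Covered (Agree i x)
      uncovered-limit ¬cov =
        let x , s~x = limit s (λ i≤j → coherent (ℕₚ.≤⇒≤′ i≤j)) in
        x , λ i (is , covers) → proj₂ (centre i)
          (is , λ y s~y → covers y (agree-trans x (s i) y (agree-sym (s i) x (s~x i)) s~y))
        where
        centre : ∀ i → UncoveredAt i
        centre zero    = let c , ¬cov′ = split 0 ¬cov in
          c , λ (is , covers) → ¬cov′ (is , λ x (_ , x∈) → covers x x∈)
        centre (suc i) = proj₁ (refine (centre i))
        s : ℕ → Carrier
        s i = proj₁ (centre i)
        -- `≤′` grows at its right end, so each step of the induction is one application of
        -- `refine`.
        coherent : ∀ {i j} → i ℕ.≤′ j → Agree i (s i) (s j)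
        coherent {i} ℕ.≤′-refl = agree-refl (s i)
        coherent {i} {suc j} (ℕ.≤′-step i≤j) = agree-trans (s i) (s j) (s (suc j)) (coherent i≤j)
          (agree-anti (s j) (s (suc j)) (ℕₚ.≤′⇒≤ i≤j) (proj₂ (refine (centre j))))

    𝒯-compact : ∀ {ℓ ι} → Compact ι (𝒯 {ℓ})
    𝒯-compact I U U-open covering = let is , covers = cov in is , λ x → covers x tt
      where
      cov : Covered U (λ _ → ⊤)
      cov = em⇒dne em λ ¬cov →
        let x , ¬cov-near-x = uncovered-limit U ¬cov
            k , x∈Uk        = covering x
            i , ⊆Uk         = open⇒neighbourhood (U k) (U-open k) x x∈Uk
        in ¬cov-near-x i (k ∷ [] , λ y x~y → here (⊆Uk y x~y))

theorem4p10 : (em : ∀ {ℓ} → ExcludedMiddle ℓ) {ℓ ι : Level} (n : ℕ) → n ≥ 1 →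
    let open HeytingAlgebra (F̂ em n)
        d = dist em n
        𝒯 = MetricTopology {ℓ = ℓ} d
    in
    IsMetric _≈_ d
    × Compact ι 𝒯
    × Hausdorff _≈_ 𝒯
    × ((U : Pred Carrier ℓ) → U ∈ 𝒯 ⇔ U ∈ ProfiniteTopology em n)
    × Continuous (𝒯 ⊗ 𝒯) 𝒯 (uncurry _∧_)
    × Continuous (𝒯 ⊗ 𝒯) 𝒯 (uncurry _∨_)
    × Continuous (𝒯 ⊗ 𝒯) 𝒯 (uncurry _⇨_)
    × IsMetricCompletion (distF em n) d proj₁
theorem4p10 em n _ =
  dist-isMetric em n , 𝒯-compact em n , 𝒯-hausdorff em n ,
  (λ U → mk⇔ (open⇒profinite em n U) (profinite⇒open em n U)) ,
  levelwise⇒continuous em n _∧_ (∧-agree em n) ,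
  levelwise⇒continuous em n _∨_ (∨-agree em n) ,
  levelwise⇒continuous em n _⇨_ (⇨-agree em n) ,
  record { isometric = λ _ _ → refl ; dense = F-dense em n ; complete = dist-complete em n }
  where open HeytingAlgebra (F̂ em n) using (_∧_; _∨_; _⇨_)
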